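{- The procedure LCPSLength(X,Y) (given in full in the context) computes the length of an LCPS of $X$ and $Y$ in $\mathcal{O}(n^4)$ time.
   Context: $X = x_1x_2\cdots x_n$ and $Y = y_1y_2\cdots y_n$ are two strings of equal length $n$ over a finite alphabet $\Sigma$. For $1\le i\le j\le n$, $X_{i,j}$ denotes the substring $x_i\cdots x_j$, and similarly $Y_{k,\ell} = y_k\cdots y_\ell$. A subsequence of a string is a sequence obtained by deleting zero or more of its characters. A string $Z = z_1\cdots z_u$ is a palindrome if it reads the same forward and backward, i.e. $z_t = z_{u-t+1}$ for all $1\le t\le \lceil u/2\rceil$. A common palindromic subsequence of two strings is a common subsequence of both that is a palindrome. A longest common palindromic subsequence (LCPS) of two strings is a common palindromic subsequence of maximum length. The procedure LCPSLength(X,Y) is a bottom-up dynamic program using an $n\times n\times n\times n$ table $lcps$, where the entry $lcps[i,j,k,\ell]$ is intended to hold the length of an LCPS of $X_{i,j}$ and $Y_{k,\ell}$. It returns the table $lcps$, and the computed length of an LCPS of $X$ and $Y$ is the entry $lcps[1,n,1,n]$. The procedure is as follows. (1) Set $n \leftarrow$ length of $X$. (2) Initialization: for $i = 1$ to $n$, for $j = 1$ to $i$, for $k = 1$ to $n$, for $\ell = 1$ to $k$ (nested loops): if ($i = j$ or $k = \ell$) and (either of $x_i$ or $x_j$ equals either of $y_k$ or $y_\ell$), then set $lcps[i,j,k,\ell] = 1$; otherwise set $lcps[i,j,k,\ell] = 0$. (3) Main computation: for $xLength = 2$ to $n$, for $yLength = 2$ to $n$, for $i = 1$ to $n - xLength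 + 1$, for $k = 1$ to $n - yLength + 1$ (nested loops): set $j = i + xLength$ and $\ell = k + yLength$; if $x_i = x_j = y_k = y_\ell$, set $lcps[i,j,k,\ell] = 2 + lcps[i+1,j-1,k+1,\ell-1]$; otherwise set $lcps[i,j,k,\ell] = \max(lcps[i+1,j,k,\ell],\, lcps[i,j-1,k,\ell],\, lcps[i,j,k+1,\ell],\, lcps[i,j,k,\ell-1])$. (4) Return $lcps$.
   Formalization: The printed procedure is corrected: j = i+xLength−1 and ℓ = k+yLength−1; the initial loops run j and ℓ up to n; when i=j or k=ℓ, all characters of X_{i,j} are compared with all of Y_{k,ℓ}, not only x_i, x_j with y_k, y_ℓ. Correctness is for n ≥ 1. -}

module Defs where

open import Data.Bool using (Bool; true; false; _∧_; _∨_; if_then_else_)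
open import Data.Fin using (Fin)
import Data.Fin.Properties as Fin
open import Data.List using (List; length; reverse)
open import Data.List.Relation.Binary.Sublist.Propositional using (_⊆_)
open import Data.Maybe using (Maybe; just; nothing)
import Data.Maybe.Properties as Maybe
open import Data.Nat using (ℕ; zero; suc; _+_; _*_; _∸_; _⊔_; _≤_; _≥_; _≡ᵇ_)
open import Data.Product using (_×_; _,_; ∃-syntax)
open import Data.Vec using (Vec; []; _∷_; toList)
open import Relation.Binary.PropositionalEquality using (_≡_)
open import Relation.Nullary using (⌊_⌋)

------------------------------------------------------------------------
-- Longest common palindromic subsequences

module _ {A : Set} where

  Palindrome : List A → Set
  Palindrome Z = reverse Z ≡ Z

  record IsCPS (X Y Z : List A) : Set where
    field
      subsequenceˡ : Z ⊆ X
      subsequenceʳ : Z ⊆ Y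
      palindrome   : Palindrome Z

  record IsLCPS (X Y Z : List A) : Set where
    field
      isCPS   : IsCPS X Y Z
      longest : ∀ W → IsCPS X Y W → length W ≤ length Z

------------------------------------------------------------------------
-- Asymptotic upper bounds

_∈O_ : (ℕ → ℕ) → (ℕ → ℕ) → Set
f ∈O g = ∃[ C ] ∃[ N ] ∀ n → n ≥ N → f n ≤ C * g n

------------------------------------------------------------------------
-- A language of imperative programs that read two strings and update a
-- four-dimensional table.  Variables bound by `for` and `set` are
-- represented by the numbers they hold at run time.

infix  9 #_
infixl 6 _⊞_ _⊟_
infix  4 _==_ _≐_
infixr 3 _and_
infixr 2 _or_
infix  1 lcps[_,_,_,_]≔_
infixr 0 _⨾_

data Expr : Set where
  #_            : ℕ → Expr
  lengthX       : Expr
  _⊞_ _⊟_       : Expr → Expr → Expr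
  maximum       : Expr → Expr → Expr
  lcps[_,_,_,_] : Expr → Expr → Expr → Expr → Expr

data Char : Set where
  x[_] y[_] : Expr → Char

data Test : Set where
  _==_      : Expr → Expr → Test
  _≐_       : Char → Char → Test
  _and_ _or_ : Test → Test → Test

data Cmd : Set where
  skip             : Cmd
  lcps[_,_,_,_]≔_  : Expr → Expr → Expr → Expr → Expr → Cmd
  _⨾_              : Cmd → Cmd → Cmd
  when             : Test → Cmd → Cmd → Cmd
  set              : Expr → (ℕ → Cmd) → Cmd
  for              : Expr → Expr → (ℕ → Cmd) → Cmd

-- `for i from a to b do c` is empty when b < a.
syntax when b c d = If b Then c Else d
syntax set e (λ v → c) = Set v := e In c
syntax for a b (λ i → c) = For i from a to b Do c

------------------------------------------------------------------------
-- Semantics.  Time is measured on a unit-cost RAM: each variable or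
-- literal, arithmetic operation, table access, character access,
-- comparison, connective, assignment, branch and loop step takes one
-- unit.

Table : Set
Table = ℕ → ℕ → ℕ → ℕ → ℕ

_[_,_,_,_↦_] : Table → ℕ → ℕ → ℕ → ℕ → ℕ → Table
(t [ i , j , k , l ↦ v ]) i′ j′ k′ l′ =
  if (i ≡ᵇ i′) ∧ (j ≡ᵇ j′) ∧ (k ≡ᵇ k′) ∧ (l ≡ᵇ l′)
  then v else t i′ j′ k′ l′

-- Positions are counted from 1.
charAt : ∀ {A : Set} {n} → Vec A n → ℕ → Maybe A
charAt _        zero          = nothing
charAt []       (suc _)       = nothing
charAt (a ∷ _)  (suc zero)    = just a
charAt (_ ∷ as) (suc (suc p)) = charAt as (suc p)

exprCost : Expr → ℕ
exprCost (# _)                 = 1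
exprCost lengthX               = 1
exprCost (d ⊞ e)               = 1 + exprCost d + exprCost e
exprCost (d ⊟ e)               = 1 + exprCost d + exprCost e
exprCost (maximum d e)         = 1 + exprCost d + exprCost e
exprCost lcps[ a , b , c , d ] =
  1 + exprCost a + exprCost b + exprCost c + exprCost d

charCost : Char → ℕ
charCost x[ e ] = 1 + exprCost e
charCost y[ e ] = 1 + exprCost e

testCost : Test → ℕ
testCost (d == e)  = 1 + exprCost d + exprCost e
testCost (c ≐ d)   = 1 + charCost c + charCost d
testCost (b and c) = 1 + testCost b + testCost c
testCost (b or c)  = 1 + testCost b + testCost c

-- Runs `f` on `start`, `start + 1`, …, `count` times in all.
iterate : (count start : ℕ) → (ℕ → Table → Table × ℕ) → Table → Table × ℕ
iterate zero        start f t = t , 1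
iterate (suc count) start f t =
  let t₁ , c₁ = f start t
      t₂ , c₂ = iterate count (suc start) f t₁
  in  t₂ , 1 + c₁ + c₂

module Run {σ n : ℕ} (X Y : Vec (Fin σ) n) where

  expr : Expr → Table → ℕ
  expr (# v)                 t = v
  expr lengthX               t = n
  expr (d ⊞ e)               t = expr d t + expr e t
  expr (d ⊟ e)               t = expr d t ∸ expr e t
  expr (maximum d e)         t = expr d t ⊔ expr e t
  expr lcps[ a , b , c , d ] t = t (expr a t) (expr b t) (expr c t) (expr d t)

  char : Char → Table → Maybe (Fin σ)
  char x[ e ] t = charAt X (expr e t)
  char y[ e ] t = charAt Y (expr e t)

  test : Test → Table → Bool
  test (d == e)  t = expr d t ≡ᵇ expr e t
  test (c ≐ d)   t = ⌊ Maybe.≡-dec Fin._≟_ (char c t) (char d t) ⌋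
  test (b and c) t = test b t ∧ test c t
  test (b or c)  t = test b t ∨ test c t

  -- The final table and the time taken.
  run : Cmd → Table → Table × ℕ
  run skip t = t , 0
  run (lcps[ a , b , c , d ]≔ e) t =
    t [ expr a t , expr b t , expr c t , expr d t ↦ expr e t ] ,
    1 + exprCost a + exprCost b + exprCost c + exprCost d + exprCost e
  run (p ⨾ q) t =
    let t₁ , c₁ = run p t
        t₂ , c₂ = run q t₁
    in  t₂ , c₁ + c₂
  run (when b p q) t =
    let t₁ , c₁ = if test b t then run p t else run q t
    in  t₁ , 1 + testCost b + c₁
  run (set e p) t =
    let t₁ , c₁ = run (p (expr e t)) t
    in  t₁ , 1 + exprCost e + c₁
  run (for a b p) t =
    let t₁ , c₁ = iterate (suc (expr b t) ∸ expr a t) (expr a t) (λ i → run (p i)) t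
    in  t₁ , 1 + exprCost a + exprCost b + c₁

open Run using (run) public

------------------------------------------------------------------------
-- The procedure.  The published pseudocode differs from this one in
-- three places.  Each is an error, even with the other two corrected:
--
--  * It sets j and ℓ to i + xLength and k + yLength.  These can be n + 1,
--    and the main loops miss the substrings of length 2: X = Y = aa gives
--    0 instead of 2.
--  * Its initial loops over j and ℓ stop at i and k.  Then X = ab, Y = ac
--    gives the maximum of four entries that are never set.
--  * It sets an entry with i = j or k = ℓ to 1 when x_i or x_j equals y_k
--    or y_ℓ.  That overlooks inner characters (X = abade, Y = acbca
--    gives 2 instead of 3) and counts characters of empty substrings,
--    which have i > j or k > ℓ (X = aab, Y = aaa gives 3 instead of 2).
--    Here all characters of X_{i,j} are compared with all those of
--    Y_{k,ℓ}; one of the two substrings has at most one character, so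
--    this takes O(n) steps for each of O(n³) entries.

initialize : (n : ℕ) → Cmd
initialize n =
  For i from # 1 to # n Do
  For j from # 1 to # n Do
  For k from # 1 to # n Do
  For l from # 1 to # n Do
    ( lcps[ # i , # j , # k , # l ]≔ # 0
    ⨾ If (# i == # j) or (# k == # l)
      Then
        (For p from # i to # j Do
         For q from # k to # l Do
           (If x[ # p ] ≐ y[ # q ]
            Then (lcps[ # i , # j , # k , # l ]≔ # 1)
            Else skip))
      Else skip )

fill : (n : ℕ) → Cmd
fill n =
  For xLength from # 2 to # n Do
  For yLength from # 2 to # n Do
  For i from # 1 to # n ⊟ # xLength ⊞ # 1 Do
  For k from # 1 to # n ⊟ # yLength ⊞ # 1 Do
  Set j := # i ⊞ # xLength ⊟ # 1 In
  Set l := # k ⊞ # yLength ⊟ # 1 In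
    (If (x[ # i ] ≐ x[ # j ]) and (x[ # j ] ≐ y[ # k ]) and (y[ # k ] ≐ y[ # l ])
     Then
       (lcps[ # i , # j , # k , # l ]≔
          # 2 ⊞ lcps[ # i ⊞ # 1 , # j ⊟ # 1 , # k ⊞ # 1 , # l ⊟ # 1 ])
     Else
       (lcps[ # i , # j , # k , # l ]≔
          maximum lcps[ # i ⊞ # 1 , # j , # k , # l ]
            (maximum lcps[ # i , # j ⊟ # 1 , # k , # l ]
              (maximum lcps[ # i , # j , # k ⊞ # 1 , # l ]
                       lcps[ # i , # j , # k , # l ⊟ # 1 ]))))

LCPSLength : Cmd
LCPSLength =
  Set n := lengthX In
    ( initialize n
    ⨾ fill n )

-- The table holds arbitrary values `t₀` before the procedure runs.
module _ {σ n : ℕ} (X Y : Vec (Fin σ) n) (t₀ : Table) where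
  open import Data.Product using (proj₁; proj₂)

  lcpsTable : Table
  lcpsTable = proj₁ (run X Y LCPSLength t₀)

  runningTime : ℕ
  runningTime = proj₂ (run X Y LCPSLength t₀)

module Submission where

-- A palindrome of length at least two that is a common subsequence of x M x′
-- and y N y′ either avoids one of the four outer characters or uses all of
-- them.  In the latter case they are equal, and removing the first and the last
-- letter leaves a common palindromic subsequence of M and N; hence the recurrence.
-- The program computes it in lexicographic order of (xLength, yLength), so the
-- entries read have their final values: a loop body never spoils a correct entry,
-- and for each entry some iteration makes it correct.
--
-- For the time bound, an initial entry costs O(n) if i = j or k = l and O(1)
-- otherwise, so a loop over l with i ≠ j is charged O(n) once for its exceptional
-- iteration l = k, and a loop over j is charged O(n³) once for j = i.

open import Algebra.Properties.CommutativeSemiring.Exp using (^-distrib-*)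
open import Data.Bool using (true; false; T; if_then_else_; _∨_)
open import Data.Bool.Properties using (∨-zeroʳ)
open import Data.Empty using (⊥-elim)
open import Data.Fin using (Fin)
import Data.Fin.Properties as Fin
open import Data.List using (List; []; _∷_; [_]; _∷ʳ_; length; reverse; map; initLast; _∷ʳ′_)
open import Data.List.Properties
  using (unfold-reverse; reverse-++; ∷-injective; ∷ʳ-injectiveˡ; length-++; length-map; map-injective; reverse-map)
open import Data.List.Relation.Binary.Sublist.Propositional
  using (_⊆_; []; _∷_; ⊆-refl; ⊆-trans; minimum) renaming (_∷ʳ_ to omit)
open import Data.List.Relation.Binary.Sublist.Propositional.Properties
  using (∷⁻; ++⁺; ++⁺ʳ; length-mono-≤; map⁺)
open import Data.Maybe using (Maybe; just)
import Data.Maybe.Properties as Maybe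
open import Data.Nat
  using (ℕ; zero; suc; _+_; _*_; _^_; _∸_; _⊔_; _≤_; _<_; z≤n; s≤s; _≡ᵇ_; _≟_; NonZero; >-nonZero⁻¹)
open import Data.Nat.Properties hiding (_≟_)
open import Data.Product using (_×_; _,_; ∃-syntax; proj₁; proj₂)
open import Data.Sum using (_⊎_; inj₁; inj₂; [_,_]′)
open import Data.Unit using (⊤; tt)
open import Data.Vec using (Vec; []; _∷_; toList)
open import Relation.Binary.PropositionalEquality
  using (_≡_; _≢_; ≢-sym; refl; sym; trans; cong; subst; subst₂)
open import Relation.Nullary using (¬_; yes; no)
open import Defs

open IsCPS

-- Palindromes and the recurrence for optimal lengths

module _ {A : Set} where

  Attains Bounds Optimal : List A → List A → ℕ → Set
  Attains X Y m = ∃[ Z ] IsCPS X Y Z × length Z ≡ m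
  Bounds  X Y m = ∀ W → IsCPS X Y W → length W ≤ m
  Optimal X Y m = Attains X Y m × Bounds X Y m

  reverse-outer : ∀ (a : A) W b → reverse (a ∷ W ∷ʳ b) ≡ b ∷ reverse W ∷ʳ a
  reverse-outer a W b = trans (unfold-reverse a (W ∷ʳ b)) (cong (_∷ʳ a) (reverse-++ W [ b ]))

  data PalindromeView : List A → Set where
    empty  : PalindromeView []
    single : ∀ z → PalindromeView [ z ]
    outer  : ∀ z W → Palindrome W → PalindromeView (z ∷ W ∷ʳ z)

  -- Reversing `z ∷ W ∷ʳ z′` exchanges its ends, so comparing first letters identifies `z` with
  -- `z′`; cancelling both ends leaves `reverse W ≡ W`.
  palindromeView : ∀ Z → Palindrome Z → PalindromeView Z
  palindromeView []      _ = empty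
  palindromeView (z ∷ Z) p with initLast Z
  ... | [] = single z
  ... | W ∷ʳ′ z′ with ∷-injective (trans (sym (reverse-outer z W z′)) p)
  ...   | refl , q = outer z W (∷ʳ-injectiveˡ (reverse W) W q)

  palindrome-outer : ∀ z W → Palindrome W → Palindrome (z ∷ W ∷ʳ z)
  palindrome-outer z W p = trans (reverse-outer z W z) (cong (λ V → z ∷ V ∷ʳ z) p)

  length-outer : ∀ (a : A) W b → length (a ∷ W ∷ʳ b) ≡ 2 + length W
  length-outer a W b = cong suc (trans (length-++ W) (+-comm (length W) 1))

  -- The constructors of `_⊆_` expose first letters only, so the last letter is reached by induction
  -- along `M`.
  ⊆-∷ʳ⁻ : ∀ {W : List A} {z} M {x} → W ∷ʳ z ⊆ M ∷ʳ x → (W ∷ʳ z ⊆ M) ⊎ (z ≡ x × W ⊆ M)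
  ⊆-∷ʳ⁻ {[]}    []      (refl ∷ _)  = inj₂ (refl , [])
  -- `W` is split until the tail of `W ∷ʳ z` computes to a nonempty list, which has no embedding
  -- into `[]`.
  ⊆-∷ʳ⁻ {w ∷ []}    []  (_ ∷ ())
  ⊆-∷ʳ⁻ {w ∷ _ ∷ _} []  (_ ∷ ())
  ⊆-∷ʳ⁻         (m ∷ M) (omit _ s)    with ⊆-∷ʳ⁻ M s
  ... | inj₁ t       = inj₁ (omit m t)
  ... | inj₂ (e , t) = inj₂ (e , omit m t)
  ⊆-∷ʳ⁻ {[]}    (m ∷ M) (refl ∷ _)  = inj₁ (refl ∷ minimum M)
  ⊆-∷ʳ⁻ {w ∷ W} (m ∷ M) (refl ∷ s)  with ⊆-∷ʳ⁻ M s
  ... | inj₁ t       = inj₁ (refl ∷ t)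
  ... | inj₂ (e , t) = inj₂ (e , refl ∷ t)

  ⊆-outer⁻ : ∀ {z z′ x x′ : A} {W M} → z ∷ W ∷ʳ z′ ⊆ x ∷ M ∷ʳ x′ →
    (z ∷ W ∷ʳ z′ ⊆ M ∷ʳ x′) ⊎ (z ∷ W ∷ʳ z′ ⊆ x ∷ M) ⊎ (z ≡ x × z′ ≡ x′)
  ⊆-outer⁻ (omit _ s) = inj₁ s
  ⊆-outer⁻ {M = M} (refl ∷ s) with ⊆-∷ʳ⁻ M s
  ... | inj₁ t       = inj₂ (inj₁ (refl ∷ t))
  ... | inj₂ (e , t) = inj₂ (inj₂ (refl , e))

  -- Whether or not `z` is placed at `x`, the rest embeds behind `x`. If `x′` is avoided there, then
  -- all of `W ∷ʳ z′`, and with it `W`, lies inside `M`.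
  ⊆-inner : ∀ {z z′ x x′ : A} {W M} → z ∷ W ∷ʳ z′ ⊆ x ∷ M ∷ʳ x′ → W ⊆ M
  ⊆-inner {z′ = z′} {M = M} s with ⊆-∷ʳ⁻ M (∷⁻ s)
  ... | inj₁ t       = ⊆-trans (++⁺ʳ [ z′ ] ⊆-refl) t
  ... | inj₂ (_ , t) = t

  ∷ʳ-⊆-outer : ∀ x M (x′ : A) → M ∷ʳ x′ ⊆ x ∷ M ∷ʳ x′
  ∷ʳ-⊆-outer x M x′ = omit x ⊆-refl

  ∷-⊆-outer : ∀ x M (x′ : A) → x ∷ M ⊆ x ∷ M ∷ʳ x′
  ∷-⊆-outer x M x′ = refl ∷ ++⁺ʳ [ x′ ] ⊆-refl

  singleton-outer⁻ : ∀ {z x x′ : A} {M} → [ z ] ⊆ x ∷ M ∷ʳ x′ → ([ z ] ⊆ M ∷ʳ x′) ⊎ ([ z ] ⊆ x ∷ M)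
  singleton-outer⁻ (omit _ s) = inj₁ s
  singleton-outer⁻ (refl ∷ _) = inj₂ (refl ∷ minimum _)

  restrictˡ : ∀ {X X′ Y W : List A} → IsCPS X Y W → W ⊆ X′ → IsCPS X′ Y W
  restrictˡ c s = record { subsequenceˡ = s ; subsequenceʳ = subsequenceʳ c ; palindrome = palindrome c }

  restrictʳ : ∀ {X Y Y′ W : List A} → IsCPS X Y W → W ⊆ Y′ → IsCPS X Y′ W
  restrictʳ c s = record { subsequenceˡ = subsequenceˡ c ; subsequenceʳ = s ; palindrome = palindrome c }

  Attains-mono : ∀ {X X′ Y Y′ m} → X ⊆ X′ → Y ⊆ Y′ → Attains X Y m → Attains X′ Y′ m
  Attains-mono s t (Z , c , e) = Z , record
    { subsequenceˡ = ⊆-trans (subsequenceˡ c) s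
    ; subsequenceʳ = ⊆-trans (subsequenceʳ c) t
    ; palindrome   = palindrome c } , e

  Attains-⊔ : ∀ {X Y} m m′ → Attains X Y m → Attains X Y m′ → Attains X Y (m ⊔ m′)
  Attains-⊔ m m′ p q with ⊔-sel m m′
  ... | inj₁ e = subst (Attains _ _) (sym e) p
  ... | inj₂ e = subst (Attains _ _) (sym e) q

  cps-outer : ∀ {M N Z} x → IsCPS M N Z → IsCPS (x ∷ M ∷ʳ x) (x ∷ N ∷ʳ x) (x ∷ Z ∷ʳ x)
  cps-outer {Z = Z} x c = record
    { subsequenceˡ = refl ∷ ++⁺ (subsequenceˡ c) ⊆-refl
    ; subsequenceʳ = refl ∷ ++⁺ (subsequenceʳ c) ⊆-refl
    ; palindrome   = palindrome-outer x Z (palindrome c) }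

  -- Wrapping an optimal inner word in `x` attains the value. Conversely, stripping both ends of a
  -- palindrome of length at least two leaves a candidate for `M` and `N`, and shorter palindromes
  -- have length at most 1.
  optimal-equal : ∀ {x x′ y y′ M N m} → x ≡ x′ → x′ ≡ y → y ≡ y′ → Optimal M N m →
    Optimal (x ∷ M ∷ʳ x′) (y ∷ N ∷ʳ y′) (2 + m)
  optimal-equal {x} {M = M} {N} {m} refl refl refl ((Z , c , e) , bound) =
    (x ∷ Z ∷ʳ x , cps-outer x c , trans (length-outer x Z x) (cong (2 +_) e)) , bound′
    where
    bound′ : Bounds (x ∷ M ∷ʳ x) (x ∷ N ∷ʳ x) (2 + m)
    bound′ W d with palindromeView W (palindrome d)
    ... | empty    = z≤n
    ... | single _ = s≤s z≤n
    ... | outer z V p = subst (_≤ 2 + m) (sym (length-outer z V z)) (s≤s (s≤s (bound V record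
      { subsequenceˡ = ⊆-inner (subsequenceˡ d)
      ; subsequenceʳ = ⊆-inner (subsequenceʳ d)
      ; palindrome   = p })))

  -- Every candidate avoids one of the four outer characters and is bounded by the corresponding
  -- `m`; the four optima themselves remain attainable in the larger strings.
  optimal-unequal : ∀ {x x′ y y′ : A} {M N : List A} {m₁ m₂ m₃ m₄} → ¬ (x ≡ x′ × x′ ≡ y × y ≡ y′) →
    Optimal (M ∷ʳ x′) (y ∷ N ∷ʳ y′) m₁ → Optimal (x ∷ M) (y ∷ N ∷ʳ y′) m₂ →
    Optimal (x ∷ M ∷ʳ x′) (N ∷ʳ y′) m₃ → Optimal (x ∷ M ∷ʳ x′) (y ∷ N) m₄ →
    Optimal (x ∷ M ∷ʳ x′) (y ∷ N ∷ʳ y′) (m₁ ⊔ (m₂ ⊔ (m₃ ⊔ m₄)))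
  optimal-unequal {x} {x′} {y} {y′} {M} {N} {m₁} {m₂} {m₃} {m₄} ne (a₁ , b₁) (a₂ , b₂) (a₃ , b₃) (a₄ , b₄) =
    Attains-⊔ m₁ _ (Attains-mono (∷ʳ-⊆-outer x M x′) ⊆-refl a₁)
      (Attains-⊔ m₂ _ (Attains-mono (∷-⊆-outer x M x′) ⊆-refl a₂)
        (Attains-⊔ m₃ m₄ (Attains-mono ⊆-refl (∷ʳ-⊆-outer y N y′) a₃)
                         (Attains-mono ⊆-refl (∷-⊆-outer y N y′) a₄))) ,
    bound
    where
    X Y : List A
    X = x ∷ M ∷ʳ x′
    Y = y ∷ N ∷ʳ y′
    use₁ : ∀ {W : List A} → IsCPS X Y W → W ⊆ M ∷ʳ x′ → length W ≤ m₁ ⊔ (m₂ ⊔ (m₃ ⊔ m₄))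
    use₁ c s = m≤n⇒m≤n⊔o _ (b₁ _ (restrictˡ c s))
    use₂ : ∀ {W : List A} → IsCPS X Y W → W ⊆ x ∷ M → length W ≤ m₁ ⊔ (m₂ ⊔ (m₃ ⊔ m₄))
    use₂ c s = m≤n⇒m≤o⊔n m₁ (m≤n⇒m≤n⊔o _ (b₂ _ (restrictˡ c s)))
    use₃ : ∀ {W : List A} → IsCPS X Y W → W ⊆ N ∷ʳ y′ → length W ≤ m₁ ⊔ (m₂ ⊔ (m₃ ⊔ m₄))
    use₃ c s = m≤n⇒m≤o⊔n m₁ (m≤n⇒m≤o⊔n m₂ (m≤n⇒m≤n⊔o m₄ (b₃ _ (restrictʳ c s))))
    use₄ : ∀ {W : List A} → IsCPS X Y W → W ⊆ y ∷ N → length W ≤ m₁ ⊔ (m₂ ⊔ (m₃ ⊔ m₄))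
    use₄ c s = m≤n⇒m≤o⊔n m₁ (m≤n⇒m≤o⊔n m₂ (m≤n⇒m≤o⊔n m₃ (b₄ _ (restrictʳ c s))))
    bound : Bounds X Y (m₁ ⊔ (m₂ ⊔ (m₃ ⊔ m₄)))
    bound W c with palindromeView W (palindrome c)
    ... | empty = z≤n
    -- A single letter cannot occupy both ends of `X`, so one of the first two bounds applies.
    ... | single _ = [ use₁ c , use₂ c ]′ (singleton-outer⁻ (subsequenceˡ c))
    -- The two ends of the palindrome are one letter, so an embedding using all four outer
    -- characters would make them equal, against `ne`.
    ... | outer _ _ _ =
      [ use₁ c , [ use₂ c , (λ (z≡x , z≡x′) →
        [ use₃ c , [ use₄ c , (λ (z≡y , z≡y′) →
          ⊥-elim (ne (trans (sym z≡x) z≡x′ , trans (sym z≡x′) z≡y , trans (sym z≡y) z≡y′))) ]′ ]′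
        (⊆-outer⁻ (subsequenceʳ c))) ]′ ]′
      (⊆-outer⁻ (subsequenceˡ c))

  -- Substrings and the values for short ones

  -- The arguments are start and length, not two ends: recursion is structural, and empty substrings
  -- are just those of length 0.
  slice : (ℕ → A) → ℕ → ℕ → List A
  slice f i zero    = []
  slice f i (suc a) = f i ∷ slice f (suc i) a

  slice-∷ʳ : ∀ f i a → slice f i (suc a) ≡ slice f i a ∷ʳ f (i + a)
  slice-∷ʳ f i zero    = cong (λ p → [ f p ]) (sym (+-identityʳ i))
  slice-∷ʳ f i (suc a) = cong (f i ∷_) (trans (slice-∷ʳ f (suc i) a)
    (cong (λ p → slice f (suc i) a ∷ʳ f p) (sym (+-suc i a))))

  length-slice : ∀ f i a → length (slice f i a) ≡ a
  length-slice f i zero    = refl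
  length-slice f i (suc a) = cong suc (length-slice f (suc i) a)

  ∈-slice⁺ : ∀ f {i a p} → i ≤ p → p < i + a → [ f p ] ⊆ slice f i a
  ∈-slice⁺ f {i} {zero} {p} i≤p p<i = ⊥-elim (<⇒≱ p<i (subst (_≤ p) (sym (+-identityʳ i)) i≤p))
  ∈-slice⁺ f {i} {suc a} {p} i≤p p< with m≤n⇒m<n∨m≡n i≤p
  ... | inj₁ i<p  = omit (f i) (∈-slice⁺ f i<p (subst (p <_) (+-suc i a) p<))
  ... | inj₂ refl = refl ∷ minimum _

  ∈-slice⁻ : ∀ f i a {c Z} → c ∷ Z ⊆ slice f i a → ∃[ p ] i ≤ p × p < i + a × c ≡ f p
  ∈-slice⁻ f i (suc a) (omit _ s) with ∈-slice⁻ f (suc i) a s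
  ... | p , i<p , p< , e = p , <⇒≤ i<p , subst (p <_) (sym (+-suc i a)) p< , e
  ∈-slice⁻ f i (suc a) (refl ∷ _) = i , ≤-refl , m<m+n i (s≤s z≤n) , refl

  length-cps : ∀ {X Y W : List A} → IsCPS X Y W → length X ≤ 1 ⊎ length Y ≤ 1 → length W ≤ 1
  length-cps c (inj₁ h) = ≤-trans (length-mono-≤ (subsequenceˡ c)) h
  length-cps c (inj₂ h) = ≤-trans (length-mono-≤ (subsequenceʳ c)) h

  -- The first letter of a nonempty common subsequence would occur in both slices.
  optimal-0 : ∀ f i a g k b →
    (∀ p q → i ≤ p → p < i + a → k ≤ q → q < k + b → f p ≢ g q) →
    Optimal (slice f i a) (slice g k b) 0
  optimal-0 f i a g k b none =
    ([] , record { subsequenceˡ = minimum _ ; subsequenceʳ = minimum _ ; palindrome = refl } , refl) , bound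
    where
    bound : Bounds (slice f i a) (slice g k b) 0
    bound []      c = z≤n
    bound (w ∷ W) c with ∈-slice⁻ f i a (subsequenceˡ c) | ∈-slice⁻ g k b (subsequenceʳ c)
    ... | p , i≤p , p< , e | q , k≤q , q< , e′ = ⊥-elim (none p q i≤p p< k≤q q< (trans (sym e) e′))

  -- The common letter alone is a palindrome; the slice of length at most one gives the upper bound.
  optimal-1 : ∀ f i a g k b p q → i ≤ p → p < i + a → k ≤ q → q < k + b → f p ≡ g q → a < 2 ⊎ b < 2 →
    Optimal (slice f i a) (slice g k b) 1
  optimal-1 f i a g k b p q i≤p p< k≤q q< e short =
    ([ f p ] , record
      { subsequenceˡ = ∈-slice⁺ f i≤p p<
      ; subsequenceʳ = subst (λ c → [ c ] ⊆ slice g k b) (sym e) (∈-slice⁺ g k≤q q<)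
      ; palindrome   = refl } , refl) ,
    λ W c → length-cps c (short′ short)
    where
    short′ : a < 2 ⊎ b < 2 → length (slice f i a) ≤ 1 ⊎ length (slice g k b) ≤ 1
    short′ (inj₁ (s≤s h)) = inj₁ (subst (_≤ 1) (sym (length-slice f i a)) h)
    short′ (inj₂ (s≤s h)) = inj₂ (subst (_≤ 1) (sym (length-slice g k b)) h)

-- `charAt` takes values in Maybe, so the slices below consist of letters `just a`.
⊆-map-just⁻ : ∀ {A : Set} {Z} (X : List A) → Z ⊆ map just X → ∃[ Z′ ] Z ≡ map just Z′ × Z′ ⊆ X
⊆-map-just⁻ []      []       = [] , refl , []
⊆-map-just⁻ (x ∷ X) (omit _ s) with ⊆-map-just⁻ X s
... | Z′ , e , t = Z′ , e , omit x t
⊆-map-just⁻ (x ∷ X) (refl ∷ s) with ⊆-map-just⁻ X s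
... | Z′ , e , t = x ∷ Z′ , cong (just x ∷_) e , refl ∷ t

map-just-⊆⁻ : ∀ {A : Set} {X Y : List A} → map just X ⊆ map just Y → X ⊆ Y
map-just-⊆⁻ {Y = Y} s with ⊆-map-just⁻ Y s
... | Z , e , t = subst (_⊆ Y) (sym (map-injective Maybe.just-injective e)) t

cps-map-just : ∀ {A : Set} {X Y Z : List A} → IsCPS X Y Z → IsCPS (map just X) (map just Y) (map just Z)
cps-map-just {Z = Z} c = record
  { subsequenceˡ = map⁺ just (subsequenceˡ c)
  ; subsequenceʳ = map⁺ just (subsequenceʳ c)
  ; palindrome   = trans (sym (reverse-map just Z)) (cong (map just) (palindrome c)) }

cps-map-just⁻ : ∀ {A : Set} {X Y Z : List A} → IsCPS (map just X) (map just Y) (map just Z) → IsCPS X Y Z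
cps-map-just⁻ {Z = Z} c = record
  { subsequenceˡ = map-just-⊆⁻ (subsequenceˡ c)
  ; subsequenceʳ = map-just-⊆⁻ (subsequenceʳ c)
  ; palindrome   = map-injective Maybe.just-injective (trans (reverse-map just Z) (palindrome c)) }

-- Mapping with `just` is injective and respects sublists, palindromes and lengths, so the witness
-- is pulled back and competitors are pushed forward.
optimal⇒lcps : ∀ {A : Set} (X Y : List A) {m} → Optimal (map just X) (map just Y) m →
  ∃[ Z ] IsLCPS X Y Z × m ≡ length Z
optimal⇒lcps X Y ((Z , c , e) , bound) with ⊆-map-just⁻ X (subsequenceˡ c)
... | Z′ , refl , _ = Z′ , record
  { isCPS   = cps-map-just⁻ c
  ; longest = λ W d → subst₂ _≤_ (length-map just W) (trans (sym e) (length-map just Z′))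
                        (bound (map just W) (cps-map-just d)) } ,
  trans (sym e) (length-map just Z′)

-- Loop invariants and sets of entries made correct

infix 4 _∈[_,_]

_∈[_,_] : ℕ → ℕ → ℕ → Set
v ∈[ lo , hi ] = lo ≤ v × v ≤ hi

step : (ℕ → Table → Table × ℕ) → ℕ → Table → Table
step f v t = proj₁ (f v t)

loop : (ℕ → Table → Table × ℕ) → ℕ → ℕ → Table → Table
loop f lo hi t = proj₁ (iterate (suc hi ∸ lo) lo f t)

iterate-induction : ∀ f (I : ℕ → Table → Set) count start t →
  (∀ v t → start ≤ v → v < start + count → I v t → I (suc v) (step f v t)) →
  I start t → I (start + count) (proj₁ (iterate count start f t))
iterate-induction f I zero start t h p = subst (λ v → I v t) (sym (+-identityʳ start)) p
iterate-induction f I (suc count) start t h p =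
  subst (λ v → I v (proj₁ (iterate (suc count) start f t))) (sym (+-suc start count))
    (iterate-induction f I count (suc start) (step f start t)
      (λ v t s<v v< → h v t (<⇒≤ s<v) (subst (v <_) (sym (+-suc start count)) v<))
      (h start t ≤-refl (m<m+n start (s≤s z≤n)) p))

-- When `lo` exceeds `hi`, truncated subtraction makes the number of iterations zero, so no `v`
-- meets the hypotheses.
range-upper : ∀ {lo hi v} → lo ≤ v → v < lo + (suc hi ∸ lo) → v ≤ hi
range-upper {lo} {hi} {v} lo≤v v< with ≤-total lo (suc hi)
... | inj₁ lo≤ = ≤-pred (subst (v <_) (m+[n∸m]≡n lo≤) v<)
... | inj₂ hi< = ⊥-elim (<⇒≱ (subst (v <_) (trans (cong (lo +_) (m≤n⇒m∸n≡0 hi<)) (+-identityʳ lo)) v<) lo≤v)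

loop-induction : ∀ f (I : ℕ → Table → Set) lo hi t →
  (∀ v t → v ∈[ lo , hi ] → I v t → I (suc v) (step f v t)) →
  I lo t → I (lo + (suc hi ∸ lo)) (loop f lo hi t)
loop-induction f I lo hi t h =
  iterate-induction f I (suc hi ∸ lo) lo t λ v t lo≤v v< → h v t (lo≤v , range-upper lo≤v v<)

loop-preserves : ∀ f (I : Table → Set) lo hi t →
  (∀ v t → v ∈[ lo , hi ] → I t → I (step f v t)) → I t → I (loop f lo hi t)
loop-preserves f I lo hi t = loop-induction f (λ _ → I) lo hi t

-- The invariant is `I` together with `Q` once the counter has passed `v₀`: iteration `v₀` produces
-- `Q` and the later ones keep it.
loop-establishes : ∀ f (I Q : Table → Set) lo hi t v₀ → v₀ ∈[ lo , hi ] →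
  (∀ v t → v ∈[ lo , hi ] → I t → I (step f v t)) →
  (∀ v t → v ∈[ lo , hi ] → I t → Q t → Q (step f v t)) →
  (∀ t → I t → Q (step f v₀ t)) →
  I t → Q (loop f lo hi t)
loop-establishes f I Q lo hi t v₀ v₀∈@(_ , v₀≤hi) keepI keepQ establish p =
  proj₂ (loop-induction f (λ v t → I t × (v₀ < v → Q t)) lo hi t body
          (p , λ v₀<lo → ⊥-elim (<⇒≱ v₀<lo (proj₁ v₀∈))))
    -- The counter ends at `lo + (suc hi ∸ lo)`, which is at least `suc hi` and thus past `v₀`.
    (≤-trans (s≤s v₀≤hi) (m≤n+m∸n (suc hi) lo))
  where
  body : ∀ v t → v ∈[ lo , hi ] → I t × (v₀ < v → Q t) →
    I (step f v t) × (v₀ < suc v → Q (step f v t))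
  body v t v∈ (p , q) = keepI v t v∈ p , λ v₀≤v → new (m≤n⇒m<n∨m≡n (≤-pred v₀≤v))
    where
    new : v₀ < v ⊎ v₀ ≡ v → Q (step f v t)
    new (inj₁ v₀<v) = keepQ v t v∈ p (q v₀<v)
    new (inj₂ refl) = establish t p

Cells : Set₁
Cells = ℕ → ℕ → ℕ → ℕ → Set

-- At most one entry changes. As a disjunction it lets a proof branch directly on whether a given
-- entry is that one.
Frame : ℕ → ℕ → ℕ → ℕ → Table → Table → Set
Frame i j k l t t′ = ∀ i′ j′ k′ l′ →
  ((i , j , k , l) ≡ (i′ , j′ , k′ , l′)) ⊎ (t′ i′ j′ k′ l′ ≡ t i′ j′ k′ l′)

module _ (Good : ℕ → ℕ → ℕ → ℕ → ℕ → Set) where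

  -- Correctness is preserved rather than values, so an entry may be written again.
  Improves : Table → Table → Set
  Improves t t′ = ∀ i j k l → Good i j k l (t i j k l) → Good i j k l (t′ i j k l)

  Achieves : (Table → Set) → Cells → (Table → Table) → Set
  Achieves Pre S F = ∀ t → Pre t →
    Improves t (F t) × (∀ i j k l → S i j k l → Good i j k l (F t i j k l))

  -- What iteration `v` makes good stays good, since all iterations only improve the table; for the
  -- same reason `Pre` survives. The set obtained is a union over `v`, so the lemma can be nested
  -- loop by loop.
  loop-achieves : ∀ {Pre} {S : ℕ → Cells} f lo hi →
    (∀ t t′ → Improves t t′ → Pre t → Pre t′) →
    (∀ v → v ∈[ lo , hi ] → Achieves Pre (S v) (step f v)) →
    Achieves Pre (λ i j k l → ∃[ v ] v ∈[ lo , hi ] × S v i j k l) (loop f lo hi)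
  loop-achieves {Pre} {S} f lo hi mono body t pre =
    proj₁ (loop-preserves f (λ t′ → Improves t t′ × Pre t′) lo hi t
      (λ { v t′ v∈ (imp , p) →
           let imp′ , _ = body v v∈ t′ p
           in  (λ i j k l g → imp′ i j k l (imp i j k l g)) , mono t′ _ imp′ p })
      ((λ _ _ _ _ g → g) , pre)) ,
    λ { i j k l (v , v∈ , s) →
        loop-establishes f Pre (λ t → Good i j k l (t i j k l)) lo hi t v v∈
          (λ v t v∈ p → mono t _ (proj₁ (body v v∈ t p)) p)
          (λ v t v∈ p → proj₁ (body v v∈ t p) i j k l)
          (λ t p → proj₂ (body v v∈ t p) i j k l s)
          pre }

  frame-achieves : ∀ {Pre} i j k l F →
    (∀ t → Pre t → Frame i j k l t (F t) × Good i j k l (F t i j k l)) →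
    Achieves Pre (λ i′ j′ k′ l′ → (i , j , k , l) ≡ (i′ , j′ , k′ , l′)) F
  frame-achieves {Pre} i j k l F h t pre with h t pre
  ... | fr , g = imp , λ { _ _ _ _ refl → g }
    where
    imp : Improves t (F t)
    imp i′ j′ k′ l′ old with fr i′ j′ k′ l′
    ... | inj₁ refl = g
    ... | inj₂ same = subst (Good i′ j′ k′ l′) (sym same) old

-- Table updates and substrings of the input

≡ᵇ-refl : ∀ m → (m ≡ᵇ m) ≡ true
≡ᵇ-refl zero    = refl
≡ᵇ-refl (suc m) = ≡ᵇ-refl m

update-same : ∀ t i j k l v → (t [ i , j , k , l ↦ v ]) i j k l ≡ v
update-same t i j k l v rewrite ≡ᵇ-refl i | ≡ᵇ-refl j | ≡ᵇ-refl k | ≡ᵇ-refl l = refl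

update-frame : ∀ t i j k l v → Frame i j k l t (t [ i , j , k , l ↦ v ])
update-frame t i j k l v i′ j′ k′ l′ with i ≡ᵇ i′ in ei | j ≡ᵇ j′ in ej | k ≡ᵇ k′ in ek | l ≡ᵇ l′ in el
... | false | _     | _     | _     = inj₂ refl
... | true  | false | _     | _     = inj₂ refl
... | true  | true  | false | _     = inj₂ refl
... | true  | true  | true  | false = inj₂ refl
... | true  | true  | true  | true
  with refl ← ≡ᵇ⇒≡ i i′ (subst T (sym ei) _) | refl ← ≡ᵇ⇒≡ j j′ (subst T (sym ej) _)
     | refl ← ≡ᵇ⇒≡ k k′ (subst T (sym ek) _) | refl ← ≡ᵇ⇒≡ l l′ (subst T (sym el) _) = inj₁ refl

slice-charAt-suc : ∀ {A : Set} {n} x (X : Vec A n) i a →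
  slice (charAt (x ∷ X)) (2 + i) a ≡ slice (charAt X) (1 + i) a
slice-charAt-suc x X i zero    = refl
slice-charAt-suc x X i (suc a) = cong (charAt X (1 + i) ∷_) (slice-charAt-suc x X (suc i) a)

slice-charAt : ∀ {A : Set} {n} (X : Vec A n) → slice (charAt X) 1 n ≡ map just (toList X)
slice-charAt []                = refl
slice-charAt {n = suc n} (x ∷ X) = cong (just x ∷_) (trans (slice-charAt-suc x X 0 n) (slice-charAt X))

slice-outer : ∀ {A : Set} (f : ℕ → A) i a →
  slice f i (2 + a) ≡ f i ∷ slice f (suc i) a ∷ʳ f (suc (i + a))
slice-outer f i a = cong (f i ∷_) (slice-∷ʳ f (suc i) a)

Frame-trans : ∀ i j k l t t′ t″ → Frame i j k l t t′ → Frame i j k l t′ t″ → Frame i j k l t t″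
Frame-trans i j k l t t′ t″ fr fr′ i′ j′ k′ l′ with fr i′ j′ k′ l′ | fr′ i′ j′ k′ l′
... | inj₁ e | _       = inj₁ e
... | inj₂ _ | inj₁ e  = inj₁ e
... | inj₂ e | inj₂ e′ = inj₂ (trans e′ e)

-- Loop bodies and index arithmetic

-- The loop bodies are named so that they can be studied at fixed indices; `initialize` and `fill`
-- unfold to them definitionally.
matchCell : (i j k l p q : ℕ) → Cmd
matchCell i j k l p q =
  If x[ # p ] ≐ y[ # q ]
  Then (lcps[ # i , # j , # k , # l ]≔ # 1)
  Else skip

initCell : (i j k l : ℕ) → Cmd
initCell i j k l =
  lcps[ # i , # j , # k , # l ]≔ # 0
  ⨾ If (# i == # j) or (# k == # l)
    Then
      (For p from # i to # j Do
       For q from # k to # l Do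
         matchCell i j k l p q)
    Else skip

fillCell : (i j k l : ℕ) → Cmd
fillCell i j k l =
  If (x[ # i ] ≐ x[ # j ]) and (x[ # j ] ≐ y[ # k ]) and (y[ # k ] ≐ y[ # l ])
  Then
    (lcps[ # i , # j , # k , # l ]≔
       # 2 ⊞ lcps[ # i ⊞ # 1 , # j ⊟ # 1 , # k ⊞ # 1 , # l ⊟ # 1 ])
  Else
    (lcps[ # i , # j , # k , # l ]≔
       maximum lcps[ # i ⊞ # 1 , # j , # k , # l ]
         (maximum lcps[ # i , # j ⊟ # 1 , # k , # l ]
           (maximum lcps[ # i , # j , # k ⊞ # 1 , # l ]
                    lcps[ # i , # j , # k , # l ⊟ # 1 ])))

fillRound : (n xLength yLength : ℕ) → Cmd
fillRound n xLength yLength =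
  For i from # 1 to # n ⊟ # xLength ⊞ # 1 Do
  For k from # 1 to # n ⊟ # yLength ⊞ # 1 Do
  Set j := # i ⊞ # xLength ⊟ # 1 In
  Set l := # k ⊞ # yLength ⊟ # 1 In
    fillCell i j k l

last-start : ∀ {n a} → a ≤ n → n ∸ a + 1 ≡ suc n ∸ a
last-start {n} {a} a≤n = trans (+-comm (n ∸ a) 1) (sym (+-∸-assoc 1 a≤n))

-- The bound on `i` is the last start of a substring of length `2 + a`; from there its last position
-- `suc (i + a)` is exactly `n`.
end≤ : ∀ {n a i} → 2 + a ≤ n → i ≤ n ∸ (2 + a) + 1 → suc (i + a) ≤ n
end≤ {n} {a} {i} a≤n i≤ = ≤-pred (subst (_≤ suc n) (trans (+-suc i (suc a)) (cong suc (+-suc i a)))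
  (m≤o∸n⇒m+n≤o i (m≤n⇒m≤1+n a≤n) (subst (i ≤_) (last-start a≤n) i≤)))

-- Shows that the loop over starts misses no substring of length `a`.
start≤ : ∀ {n a i} → a ≤ n → i + a ≤ suc n → i ≤ n ∸ a + 1
start≤ {n} {a} {i} a≤n h = subst (i ≤_) (sym (last-start a≤n)) (m+n≤o⇒m≤o∸n i h)

i+[2+a] : ∀ i a → i + (2 + a) ≡ 2 + (i + a)
i+[2+a] i a = trans (+-suc i (suc a)) (cong suc (+-suc i a))

-- Correctness of the initialization and of the main computation

module _ {σ n : ℕ} (X Y : Vec (Fin σ) n) where

  private
    f g : ℕ → Maybe (Fin σ)
    f = charAt X
    g = charAt Y

  exec : Cmd → Table → Table
  exec c t = proj₁ (run X Y c t)

  -- X_{i,j} is addressed by its length a = j + 1 - i, so nothing is claimed when i > j + 1.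
  Correct ShortCorrect : ℕ → ℕ → ℕ → ℕ → ℕ → Set
  Correct i j k l v = ∀ a b → i + a ≡ suc j → k + b ≡ suc l → Optimal (slice f i a) (slice g k b) v
  ShortCorrect i j k l v = ∀ a b → i + a ≡ suc j → k + b ≡ suc l → a < 2 ⊎ b < 2 →
    Optimal (slice f i a) (slice g k b) v

  module _ (i j k l : ℕ) where

    Match : Set
    Match = ∃[ p ] ∃[ q ] p ∈[ i , j ] × q ∈[ k , l ] × f p ≡ g q

    match⇒correct : Match → ShortCorrect i j k l 1
    match⇒correct (p , q , (i≤p , p≤j) , (k≤q , q≤l) , e) a b ea eb =
      optimal-1 f i a g k b p q i≤p (subst (p <_) (sym ea) (s≤s p≤j)) k≤q (subst (q <_) (sym eb) (s≤s q≤l)) e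

    ¬match⇒correct : ¬ Match → Correct i j k l 0
    ¬match⇒correct none a b ea eb = optimal-0 f i a g k b λ p q i≤p p< k≤q q< e →
      none (p , q , (i≤p , ≤-pred (subst (p <_) ea p<)) , (k≤q , ≤-pred (subst (q <_) eb q<)) , e)

    -- Invariant of the search: a stored 1 is always backed by a match. That a match forces a 1 is
    -- `matches-sets`.
    Marked : Table → Table → Set
    Marked t t′ = Frame i j k l t t′ × (t′ i j k l ≡ 0 ⊎ (t′ i j k l ≡ 1 × Match))

    matchCell-marks : ∀ t p q t′ → p ∈[ i , j ] → q ∈[ k , l ] → Marked t t′ →
      Marked t (exec (matchCell i j k l p q) t′)
    matchCell-marks t p q t′ p∈ q∈ (fr , v) with Maybe.≡-dec Fin._≟_ (charAt X p) (charAt Y q)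
    ... | no _  = fr , v
    ... | yes e = Frame-trans i j k l t t′ _ fr (update-frame t′ i j k l 1) ,
                  inj₂ (update-same t′ i j k l 1 , p , q , p∈ , q∈ , e)

    matchCell-keeps : ∀ p q t → t i j k l ≡ 1 → exec (matchCell i j k l p q) t i j k l ≡ 1
    matchCell-keeps p q t v with Maybe.≡-dec Fin._≟_ (charAt X p) (charAt Y q)
    ... | no _  = v
    ... | yes _ = update-same t i j k l 1

    matchCell-sets : ∀ p q t → f p ≡ g q → exec (matchCell i j k l p q) t i j k l ≡ 1
    matchCell-sets p q t e with Maybe.≡-dec Fin._≟_ (charAt X p) (charAt Y q)
    ... | no ¬e = ⊥-elim (¬e e)
    ... | yes _ = update-same t i j k l 1

    matchRow : ℕ → Cmd
    matchRow p = For q from # k to # l Do matchCell i j k l p q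

    matchRow-marks : ∀ t p t′ → p ∈[ i , j ] → Marked t t′ → Marked t (exec (matchRow p) t′)
    matchRow-marks t p t′ p∈ = loop-preserves (λ q → run X Y (matchCell i j k l p q)) (Marked t) k l t′
      λ q t″ q∈ → matchCell-marks t p q t″ p∈ q∈

    matchRow-keeps : ∀ p t → t i j k l ≡ 1 → exec (matchRow p) t i j k l ≡ 1
    matchRow-keeps p t = loop-preserves (λ q → run X Y (matchCell i j k l p q)) (λ t → t i j k l ≡ 1) k l t
      λ q t′ _ → matchCell-keeps p q t′

    matchRow-sets : ∀ p q t → q ∈[ k , l ] → f p ≡ g q → exec (matchRow p) t i j k l ≡ 1
    matchRow-sets p q t q∈ e =
      loop-establishes (λ q → run X Y (matchCell i j k l p q)) (λ _ → ⊤) (λ t → t i j k l ≡ 1) k l t q q∈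
        (λ _ _ _ _ → tt) (λ q′ t′ _ _ → matchCell-keeps p q′ t′) (λ t′ _ → matchCell-sets p q t′ e) tt

    matches : Cmd
    matches = For p from # i to # j Do matchRow p

    matches-marks : ∀ t t′ → Marked t t′ → Marked t (exec matches t′)
    matches-marks t t′ = loop-preserves (λ p → run X Y (matchRow p)) (Marked t) i j t′
      λ p t″ → matchRow-marks t p t″

    matches-sets : ∀ t → Match → exec matches t i j k l ≡ 1
    matches-sets t (p , q , p∈ , q∈ , e) =
      loop-establishes (λ p → run X Y (matchRow p)) (λ _ → ⊤) (λ t → t i j k l ≡ 1) i j t p p∈
        (λ _ _ _ _ → tt) (λ p′ t′ _ _ → matchRow-keeps p′ t′) (λ t′ _ → matchRow-sets p q t′ q∈ e) tt

    -- A stored 1 has a match to justify it, and a stored 0 excludes one, because a match would have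
    -- forced a 1.
    marked⇒correct : ∀ t t′ → Marked t t′ → (Match → t′ i j k l ≡ 1) → ShortCorrect i j k l (t′ i j k l)
    marked⇒correct t t′ (_ , inj₂ (v , m)) _ = subst (ShortCorrect i j k l) (sym v) (match⇒correct m)
    marked⇒correct t t′ (_ , inj₁ v) h a b ea eb _ = subst (Optimal _ _) (sym v)
      (¬match⇒correct (λ m → 0≢1+n (trans (sym v) (h m))) a b ea eb)

    -- A position `p` in the range rules out length 0, and length 1 means that the ends coincide.
    short⇒≡ : ∀ {i j a} → i + a ≡ suc j → a < 2 → ∀ {p} → i ≤ p → p ≤ j → i ≡ j
    short⇒≡ {i} {j} {zero} e _ i≤p p≤j =
      ⊥-elim (<⇒≱ (subst (j <_) (trans (sym e) (+-identityʳ i)) ≤-refl) (≤-trans i≤p p≤j))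
    short⇒≡ {i} {a = suc zero} e _ _ _ = suc-injective (trans (+-comm 1 i) e)
    short⇒≡ {a = suc (suc _)} _ (s≤s (s≤s ())) _ _

    initCell-correct : ∀ t → Frame i j k l t (exec (initCell i j k l) t) ×
      ShortCorrect i j k l (exec (initCell i j k l) t i j k l)
    initCell-correct t with (i ≡ᵇ j) ∨ (k ≡ᵇ l) in eq
    ... | true  = proj₁ m , marked⇒correct t _ m (matches-sets _)
      where
      m : Marked t (exec matches (t [ i , j , k , l ↦ 0 ]))
      m = matches-marks t _ (update-frame t i j k l 0 , inj₁ (update-same t i j k l 0))
    -- Here `i ≢ j` and `k ≢ l`, so the short substring is empty, no match exists and 0 is right.
    ... | false = update-frame t i j k l 0 ,
      λ a b ea eb short → subst (Optimal _ _) (sym (update-same t i j k l 0))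
        (¬match⇒correct′ short ea eb)
      where
      i≢j : i ≢ j
      i≢j refl with trans (sym eq) (cong (_∨ (k ≡ᵇ l)) (≡ᵇ-refl i))
      ... | ()
      k≢l : k ≢ l
      k≢l refl with trans (sym eq) (trans (cong ((i ≡ᵇ j) ∨_) (≡ᵇ-refl k)) (∨-zeroʳ (i ≡ᵇ j)))
      ... | ()
      ¬match⇒correct′ : ∀ {a b} → a < 2 ⊎ b < 2 → i + a ≡ suc j → k + b ≡ suc l →
        Optimal (slice f i a) (slice g k b) 0
      ¬match⇒correct′ (inj₁ a<2) ea eb = ¬match⇒correct
        (λ { (p , q , (i≤p , p≤j) , _) → i≢j (short⇒≡ ea a<2 i≤p p≤j) }) _ _ ea eb
      ¬match⇒correct′ (inj₂ b<2) ea eb = ¬match⇒correct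
        (λ { (p , q , _ , (k≤q , q≤l) , _) → k≢l (short⇒≡ eb b<2 k≤q q≤l) }) _ _ ea eb

  -- Entries with `i ≡ suc j` are included: they stand for empty substrings, which the recurrence
  -- reads when a length is 2.
  InTable : Cells
  InTable i j k l = i ∈[ 1 , n ] × j ∈[ 1 , n ] × k ∈[ 1 , n ] × l ∈[ 1 , n ]

  initialize-correct : ∀ t i j k l → InTable i j k l → ShortCorrect i j k l (exec (initialize n) t i j k l)
  initialize-correct t i j k l (i∈ , j∈ , k∈ , l∈) =
    proj₂ (all t tt) i j k l (i , i∈ , j , j∈ , k , k∈ , l , l∈ , refl)
    where
    all : Achieves ShortCorrect (λ _ → ⊤)
      (λ i′ j′ k′ l′ → ∃[ i ] i ∈[ 1 , n ] × ∃[ j ] j ∈[ 1 , n ] × ∃[ k ] k ∈[ 1 , n ] × ∃[ l ] l ∈[ 1 , n ] ×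
        (i , j , k , l) ≡ (i′ , j′ , k′ , l′))
      (exec (initialize n))
    all = loop-achieves ShortCorrect _ 1 n _ λ i _ →
          loop-achieves ShortCorrect _ 1 n _ λ j _ →
          loop-achieves ShortCorrect _ 1 n _ λ k _ →
          loop-achieves ShortCorrect _ 1 n _ λ l _ →
          frame-achieves ShortCorrect i j k l (exec (initCell i j k l)) λ t _ → initCell-correct i j k l t

  -- Y-substrings of length b′ < 2 are already handled by the initialization.
  Earlier : (a b a′ b′ : ℕ) → Set
  Earlier a b a′ b′ = a′ < a ⊎ (a′ ≡ a × b′ < b) ⊎ b′ < 2

  -- The invariant of `fill` on entering the round for lengths `a` and `b`.
  Ready : (a b : ℕ) → Table → Set
  Ready a b t = ∀ i j k l a′ b′ → InTable i j k l → i + a′ ≡ suc j → k + b′ ≡ suc l → Earlier a b a′ b′ →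
    Correct i j k l (t i j k l)

  Ready-mono : ∀ {a b} t t′ → Improves Correct t t′ → Ready a b t → Ready a b t′
  Ready-mono t t′ imp r i j k l a′ b′ ∈T ea eb early = imp i j k l (r i j k l a′ b′ ∈T ea eb early)

  -- Writing the lengths as `2 + a` and `2 + b` exposes the outer characters without subtraction.
  -- The entries read have lengths `(a, b)`, `(1 + a, 2 + b)` or `(2 + a, 1 + b)`, all earlier in
  -- the order.
  fillCell-correct : ∀ i a k b t → 1 ≤ i → suc (i + a) ≤ n → 1 ≤ k → suc (k + b) ≤ n → Ready (2 + a) (2 + b) t →
    let j = suc (i + a) ; l = suc (k + b) in
    Frame i j k l t (exec (fillCell i j k l) t) × Correct i j k l (exec (fillCell i j k l) t i j k l)
  fillCell-correct i a k b t 1≤i j≤n 1≤k l≤n r = result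
    where
    j l : ℕ
    j = suc (i + a)
    l = suc (k + b)
    i+1≡ : i + 1 ≡ suc i
    i+1≡ = +-comm i 1
    k+1≡ : k + 1 ≡ suc k
    k+1≡ = +-comm k 1
    i∈ : i ∈[ 1 , n ]
    i∈ = 1≤i , ≤-trans (m≤m+n i a) (<⇒≤ j≤n)
    1+i∈ : suc i ∈[ 1 , n ]
    1+i∈ = s≤s z≤n , ≤-trans (s≤s (m≤m+n i a)) j≤n
    j∈ : j ∈[ 1 , n ]
    j∈ = s≤s z≤n , j≤n
    j∸1∈ : i + a ∈[ 1 , n ]
    j∸1∈ = ≤-trans 1≤i (m≤m+n i a) , <⇒≤ j≤n
    k∈ : k ∈[ 1 , n ]
    k∈ = 1≤k , ≤-trans (m≤m+n k b) (<⇒≤ l≤n)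
    1+k∈ : suc k ∈[ 1 , n ]
    1+k∈ = s≤s z≤n , ≤-trans (s≤s (m≤m+n k b)) l≤n
    l∈ : l ∈[ 1 , n ]
    l∈ = s≤s z≤n , l≤n
    l∸1∈ : k + b ∈[ 1 , n ]
    l∸1∈ = ≤-trans 1≤k (m≤m+n k b) , <⇒≤ l≤n
    read : ∀ i′ j′ k′ l′ a′ b′ → InTable i′ j′ k′ l′ → i′ + a′ ≡ suc j′ → k′ + b′ ≡ suc l′ →
      Earlier (2 + a) (2 + b) a′ b′ → Optimal (slice f i′ a′) (slice g k′ b′) (t i′ j′ k′ l′)
    read i′ j′ k′ l′ a′ b′ ∈T ea eb early = r i′ j′ k′ l′ a′ b′ ∈T ea eb early a′ b′ ea eb
    whole : ∀ {v} →
      Optimal (f i ∷ slice f (suc i) a ∷ʳ f j) (g k ∷ slice g (suc k) b ∷ʳ g l) v → Correct i j k l v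
    whole {v} o a′ b′ ea eb
      -- The ends `j` and `l` leave `2 + a` and `2 + b` as the only possible lengths.
      with refl ← +-cancelˡ-≡ i a′ (2 + a) (trans ea (sym (i+[2+a] i a)))
         | refl ← +-cancelˡ-≡ k b′ (2 + b) (trans eb (sym (i+[2+a] k b))) =
      subst₂ (λ U V → Optimal U V v) (sym (slice-outer f i a)) (sym (slice-outer g k b)) o
    store : ∀ v → Correct i j k l v →
      Frame i j k l t (t [ i , j , k , l ↦ v ]) × Correct i j k l ((t [ i , j , k , l ↦ v ]) i j k l)
    store v c = update-frame t i j k l v , subst (Correct i j k l) (sym (update-same t i j k l v)) c
    equal : f i ≡ f j → f j ≡ g k → g k ≡ g l → Correct i j k l (2 + t (i + 1) (i + a) (k + 1) (k + b))
    equal e₁ e₂ e₃ = whole (optimal-equal e₁ e₂ e₃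
      (subst₂ (λ i′ k′ → Optimal (slice f (suc i) a) (slice g (suc k) b) (t i′ (i + a) k′ (k + b))) (sym i+1≡) (sym k+1≡)
        (read (suc i) (i + a) (suc k) (k + b) a b (1+i∈ , j∸1∈ , 1+k∈ , l∸1∈) refl refl (inj₁ (s≤s (n≤1+n a))))))
    unequal : ¬ (f i ≡ f j × f j ≡ g k × g k ≡ g l) →
      Correct i j k l (t (i + 1) j k l ⊔ (t i (i + a) k l ⊔ (t i j (k + 1) l ⊔ t i j k (k + b))))
    unequal ne = whole (optimal-unequal ne
      (subst₂ (λ U i′ → Optimal U Y′ (t i′ j k l)) (slice-∷ʳ f (suc i) a) (sym i+1≡)
        (subst (λ V → Optimal (slice f (suc i) (suc a)) V (t (suc i) j k l)) (slice-outer g k b)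
          (read (suc i) j k l (suc a) (2 + b) (1+i∈ , j∈ , k∈ , l∈) (cong suc (+-suc i a)) (i+[2+a] k b)
            (inj₁ ≤-refl))))
      (subst (λ V → Optimal (slice f i (suc a)) V (t i (i + a) k l)) (slice-outer g k b)
        (read i (i + a) k l (suc a) (2 + b) (i∈ , j∸1∈ , k∈ , l∈) (+-suc i a) (i+[2+a] k b) (inj₁ ≤-refl)))
      (subst₂ (λ V k′ → Optimal X′ V (t i j k′ l)) (slice-∷ʳ g (suc k) b) (sym k+1≡)
        (subst (λ U → Optimal U (slice g (suc k) (suc b)) (t i j (suc k) l)) (slice-outer f i a)
          (read i j (suc k) l (2 + a) (suc b) (i∈ , j∈ , 1+k∈ , l∈) (i+[2+a] i a) (cong suc (+-suc k b))
            (inj₂ (inj₁ (refl , ≤-refl))))))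
      (subst (λ U → Optimal U (slice g k (suc b)) (t i j k (k + b))) (slice-outer f i a)
        (read i j k (k + b) (2 + a) (suc b) (i∈ , j∈ , k∈ , l∸1∈) (i+[2+a] i a) (+-suc k b)
          (inj₂ (inj₁ (refl , ≤-refl))))))
      where
      X′ = f i ∷ slice f (suc i) a ∷ʳ f j
      Y′ = g k ∷ slice g (suc k) b ∷ʳ g l
    result : Frame i j k l t (exec (fillCell i j k l) t) × Correct i j k l (exec (fillCell i j k l) t i j k l)
    result with Maybe.≡-dec Fin._≟_ (charAt X i) (charAt X j)
              | Maybe.≡-dec Fin._≟_ (charAt X j) (charAt Y k)
              | Maybe.≡-dec Fin._≟_ (charAt Y k) (charAt Y l)
    ... | yes e₁ | yes e₂ | yes e₃ = store _ (equal e₁ e₂ e₃)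
    ... | yes _  | yes _  | no ne  = store _ (unequal (λ (_ , _ , e) → ne e))
    ... | yes _  | no ne  | _      = store _ (unequal (λ (_ , e , _) → ne e))
    ... | no ne  | _      | _      = store _ (unequal (λ (e , _) → ne e))

  -- The entries of lengths exactly `(a, b)` are the only ones newly required; the round computes
  -- them and spoils none of the earlier ones.
  fillRound-ready : ∀ a b t → a ∈[ 2 , n ] → b ∈[ 2 , n ] → Ready a b t → Ready a (suc b) (exec (fillRound n a b) t)
  fillRound-ready (suc (suc a)) (suc (suc b)) t (_ , a≤n) (_ , b≤n) r = result
    where
    S : ℕ → ℕ → Cells
    S i k i′ j′ k′ l′ = (i , suc (i + a) , k , suc (k + b)) ≡ (i′ , j′ , k′ , l′)
    all : Achieves Correct (Ready (2 + a) (2 + b))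
      (λ i′ j′ k′ l′ → ∃[ i ] i ∈[ 1 , n ∸ (2 + a) + 1 ] × ∃[ k ] k ∈[ 1 , n ∸ (2 + b) + 1 ] × S i k i′ j′ k′ l′)
      (exec (fillRound n (2 + a) (2 + b)))
    all = loop-achieves Correct _ 1 _ Ready-mono λ i (1≤i , i≤) →
          loop-achieves Correct _ 1 _ Ready-mono λ k (1≤k , k≤) →
          -- The program holds the ends as `i + (2 + a) ∸ 1` and `k + (2 + b) ∸ 1`, which are
          -- rewritten as successors.
          subst₂ (λ j l → Achieves Correct (Ready (2 + a) (2 + b)) (S i k) (exec (fillCell i j k l)))
            (sym (cong (_∸ 1) (i+[2+a] i a))) (sym (cong (_∸ 1) (i+[2+a] k b)))
            (frame-achieves Correct i (suc (i + a)) k (suc (k + b)) (exec (fillCell i (suc (i + a)) k (suc (k + b))))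
              λ t → fillCell-correct i a k b t 1≤i (end≤ a≤n i≤) 1≤k (end≤ b≤n k≤))
    t′ = exec (fillRound n (2 + a) (2 + b)) t
    old : Ready (2 + a) (2 + b) t′
    old = Ready-mono t t′ (proj₁ (all t r)) r
    result : Ready (2 + a) (3 + b) t′
    result i j k l a′ b′ ∈T ea eb (inj₁ a′<a) = old i j k l a′ b′ ∈T ea eb (inj₁ a′<a)
    result i j k l a′ b′ ∈T ea eb (inj₂ (inj₂ b′<2)) = old i j k l a′ b′ ∈T ea eb (inj₂ (inj₂ b′<2))
    result i j k l a′ b′ ∈T ea eb (inj₂ (inj₁ (refl , s≤s b′≤b))) with m≤n⇒m<n∨m≡n b′≤b
    ... | inj₁ b′<b = old i j k l a′ b′ ∈T ea eb (inj₂ (inj₁ (refl , b′<b)))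
    -- Both lengths are those of this round. Start and length determine the ends, so the entry is
    -- one the loops have visited.
    ... | inj₂ refl with suc-injective (trans (sym (i+[2+a] i a)) ea) | suc-injective (trans (sym (i+[2+a] k b)) eb) | ∈T
    ...   | refl | refl | (1≤i , _) , (_ , j≤n) , (1≤k , _) , (_ , l≤n) =
      proj₂ (all t r) i j k l
        (i , (1≤i , start≤ a≤n (subst (_≤ suc n) (sym ea) (s≤s j≤n))) ,
         k , (1≤k , start≤ b≤n (subst (_≤ suc n) (sym eb) (s≤s l≤n))) , refl)
  fillRound-ready (suc zero) _ _ (s≤s () , _) _ _
  fillRound-ready (suc (suc _)) (suc zero) _ _ (s≤s () , _) _

  length≤ : ∀ {i j a} → 1 ≤ i → j ≤ n → i + a ≡ suc j → a ≤ n
  length≤ {i} {j} {a} 1≤i j≤n e = ≤-trans (≤-pred (subst (suc a ≤_) e (+-monoˡ-≤ a 1≤i))) j≤n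

  -- `Ready a 2` is the outer invariant and `Ready a b` the inner one. A finished inner loop has
  -- covered every length in `Y`, which turns it into `Ready (suc a) 2`.
  fill-correct : ∀ t → (∀ i j k l → InTable i j k l → ShortCorrect i j k l (t i j k l)) →
    ∀ i j k l → InTable i j k l → Correct i j k l (exec (fill n) t i j k l)
  fill-correct t init i j k l ∈T a b ea eb =
    loop-induction _ (λ a → Ready a 2) 2 n t
      (λ a t a∈ r → next a _ (loop-induction _ (Ready a) 2 n t (λ b t b∈ → fillRound-ready a b t a∈ b∈) r))
      start
      i j k l a b ∈T ea eb
      -- The outer counter ends at `2 + (suc n ∸ 2)`, at least `suc n`, while every substring has
      -- length at most `n`.
      (inj₁ (≤-trans (s≤s (length≤ (proj₁ (proj₁ ∈T)) (proj₂ (proj₁ (proj₂ ∈T))) ea)) (m≤n+m∸n (suc n) 2)))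
      a b ea eb
    where
    start : Ready 2 2 t
    start i j k l a′ b′ ∈T ea eb early a b ea′ eb′
      with refl ← +-cancelˡ-≡ i a a′ (trans ea′ (sym ea)) | refl ← +-cancelˡ-≡ k b b′ (trans eb′ (sym eb)) =
      init i j k l ∈T a b ea eb (short early)
      where
      short : Earlier 2 2 a b → a < 2 ⊎ b < 2
      short (inj₁ a<2)              = inj₁ a<2
      short (inj₂ (inj₁ (_ , b<2))) = inj₂ b<2
      short (inj₂ (inj₂ b<2))       = inj₂ b<2
    next : ∀ a t → Ready a (2 + (suc n ∸ 2)) t → Ready (suc a) 2 t
    next a t r i j k l a′ b′ ∈T@(_ , _ , (1≤k , _) , (_ , l≤n)) ea eb early = r i j k l a′ b′ ∈T ea eb (earlier early)
      where
      earlier : Earlier (suc a) 2 a′ b′ → Earlier a (2 + (suc n ∸ 2)) a′ b′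
      earlier (inj₂ (inj₁ (_ , b′<2))) = inj₂ (inj₂ b′<2)
      earlier (inj₂ (inj₂ b′<2))       = inj₂ (inj₂ b′<2)
      earlier (inj₁ (s≤s a′≤a)) with m≤n⇒m<n∨m≡n a′≤a
      ... | inj₁ a′<a = inj₁ a′<a
      ... | inj₂ a′≡a = inj₂ (inj₁ (a′≡a , ≤-trans (s≤s (length≤ 1≤k l≤n eb)) (m≤n+m∸n (suc n) 2)))

  -- `1 ≤ n` puts the entry `[1, n, 1, n]` inside the table; for `n = 0` no loop body runs and it
  -- keeps its initial value.
  LCPSLength-correct : ∀ t → 1 ≤ n → Optimal (map just (toList X)) (map just (toList Y)) (lcpsTable X Y t 1 n 1 n)
  LCPSLength-correct t 1≤n =
    subst₂ (λ U V → Optimal U V (lcpsTable X Y t 1 n 1 n)) (slice-charAt X) (slice-charAt Y)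
      (fill-correct _ (initialize-correct t) 1 n 1 n (1∈ , n∈ , 1∈ , n∈) n n refl refl)
    where
    1∈ : 1 ∈[ 1 , n ]
    1∈ = ≤-refl , 1≤n
    n∈ : n ∈[ 1 , n ]
    n∈ = 1≤n , ≤-refl

-- Running time

open ≤-Reasoning

iterate-cost : ∀ f K count start t →
  (∀ v t → start ≤ v → v < start + count → proj₂ (f v t) ≤ K) →
  proj₂ (iterate count start f t) ≤ 1 + count * (1 + K)
iterate-cost f K zero        start t h = s≤s z≤n
iterate-cost f K (suc count) start t h = s≤s (begin
  proj₂ (f start t) + proj₂ (iterate count (suc start) f (step f start t))
    ≤⟨ +-mono-≤ (h start t ≤-refl (m<m+n start (s≤s z≤n)))
         (iterate-cost f K count (suc start) (step f start t)
           λ v t s<v v< → h v t (<⇒≤ s<v) (subst (v <_) (sym (+-suc start count)) v<)) ⟩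
  K + (1 + count * (1 + K)) ≡⟨ +-suc K (count * (1 + K)) ⟩
  suc count * (1 + K) ∎)

-- The iteration `s` occurs at most once, so its cost `L` is added once; after it, `iterate-cost`
-- handles the rest.
iterate-cost-except : ∀ f K L s count start t →
  (∀ v t → start ≤ v → v < start + count → v ≢ s → proj₂ (f v t) ≤ K) →
  (∀ t → start ≤ s → s < start + count → proj₂ (f s t) ≤ L) →
  proj₂ (iterate count start f t) ≤ 1 + count * (1 + K) + L
iterate-cost-except f K L s zero        start t h hₛ = s≤s z≤n
iterate-cost-except f K L s (suc count) start t h hₛ with start ≟ s
... | yes refl = s≤s (begin
  proj₂ (f s t) + proj₂ (iterate count (suc s) f (step f s t))
    ≤⟨ +-mono-≤ (hₛ t ≤-refl (m<m+n s (s≤s z≤n)))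
         (iterate-cost f K count (suc s) (step f s t)
           λ v t s<v v< → h v t (<⇒≤ s<v) (subst (v <_) (sym (+-suc s count)) v<) (λ v≡s → <⇒≢ s<v (sym v≡s))) ⟩
  L + (1 + count * (1 + K)) ≤⟨ +-monoʳ-≤ L (s≤s (m≤n+m (count * (1 + K)) K)) ⟩
  L + suc count * (1 + K)   ≡⟨ +-comm L (suc count * (1 + K)) ⟩
  suc count * (1 + K) + L   ∎)
... | no start≢s = s≤s (begin
  proj₂ (f start t) + proj₂ (iterate count (suc start) f (step f start t))
    ≤⟨ +-mono-≤ (h start t ≤-refl (m<m+n start (s≤s z≤n)) start≢s)
         (iterate-cost-except f K L s count (suc start) (step f start t)
           (λ v t s<v v< → h v t (<⇒≤ s<v) (subst (v <_) (sym (+-suc start count)) v<))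
           (λ t s<s s< → hₛ t (<⇒≤ s<s) (subst (s <_) (sym (+-suc start count)) s<))) ⟩
  K + (1 + (count * (1 + K) + L))   ≡⟨ +-suc K (count * (1 + K) + L) ⟩
  suc (K + (count * (1 + K) + L))   ≡⟨ cong suc (sym (+-assoc K (count * (1 + K)) L)) ⟩
  suc count * (1 + K) + L ∎)

if-cost : ∀ b {p q : Table × ℕ} {K} → proj₂ p ≤ K → proj₂ q ≤ K → proj₂ (if b then p else q) ≤ K
if-cost true  p q = p
if-cost false p q = q

-- As `N` is positive, additive constants are absorbed into `N ^ (e + k)`. The constant collects the
-- overhead `o`, one unit for leaving the loop, one per loop step, and `C` for the body.
loop-bound : ∀ N .{{_ : NonZero N}} o count C k e → count ≤ N ^ e →
  o + (1 + count * (1 + C * N ^ k)) ≤ (o + (2 + C)) * N ^ (e + k)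
loop-bound N o count C k e count≤ = begin
  o + (1 + count * (1 + C * N ^ k))
    ≤⟨ +-monoʳ-≤ o (+-mono-≤ (m^n>0 N (e + k)) (*-mono-≤ count≤ (+-monoˡ-≤ (C * N ^ k) (m^n>0 N k)))) ⟩
  o + (N ^ (e + k) + N ^ e * (suc C * N ^ k))
    ≤⟨ +-monoˡ-≤ _ (m≤m*n o (N ^ (e + k)) {{m^n≢0 N (e + k)}}) ⟩
  o * N ^ (e + k) + (N ^ (e + k) + N ^ e * (suc C * N ^ k))
    ≡⟨ cong (λ m → o * N ^ (e + k) + (N ^ (e + k) + m)) swap ⟩
  o * N ^ (e + k) + (2 + C) * N ^ (e + k)
    ≡⟨ sym (*-distribʳ-+ (N ^ (e + k)) o (2 + C)) ⟩
  (o + (2 + C)) * N ^ (e + k) ∎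
  where
  swap : N ^ e * (suc C * N ^ k) ≡ suc C * N ^ (e + k)
  swap = begin-equality
    N ^ e * (suc C * N ^ k) ≡⟨ sym (*-assoc (N ^ e) (suc C) (N ^ k)) ⟩
    N ^ e * suc C * N ^ k   ≡⟨ cong (_* N ^ k) (*-comm (N ^ e) (suc C)) ⟩
    suc C * N ^ e * N ^ k   ≡⟨ *-assoc (suc C) (N ^ e) (N ^ k) ⟩
    suc C * (N ^ e * N ^ k) ≡⟨ cong (suc C *_) (sym (^-distribˡ-+-* N e k)) ⟩
    suc C * N ^ (e + k)     ∎

≡ᵇ-≢ : ∀ {m n} → m ≢ n → (m ≡ᵇ n) ≡ false
≡ᵇ-≢ {m} {n} m≢n with m ≡ᵇ n in eq
... | true  = ⊥-elim (m≢n (≡ᵇ⇒≡ m n (subst T (sym eq) _)))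
... | false = refl

module _ {σ n : ℕ} (X Y : Vec (Fin σ) n) where

  private
    -- Powers of `suc n` are positive even for `n = 0`, so they can absorb constants.
    N = suc n

  value : Expr → Table → ℕ
  value = Run.expr X Y

  cost : Cmd → Table → ℕ
  cost c t = proj₂ (run X Y c t)

  -- The exponent `e` measures the loop: 0 for at most one iteration, 1 for at most `N`. Exponents
  -- add under nesting.
  for-cost : ∀ a b p C k e t → suc (value b t) ∸ value a t ≤ N ^ e →
    (∀ v t′ → v ∈[ value a t , value b t ] → cost (p v) t′ ≤ C * N ^ k) →
    cost (for a b p) t ≤ (1 + exprCost a + exprCost b + (2 + C)) * N ^ (e + k)
  for-cost a b p C k e t count≤ body = ≤-trans
    (+-monoʳ-≤ (1 + exprCost a + exprCost b) (iterate-cost (λ v → run X Y (p v)) (C * N ^ k) _ (value a t) t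
      λ v t′ lo≤v v< → body v t′ (lo≤v , range-upper lo≤v v<)))
    (loop-bound N (1 + exprCost a + exprCost b) _ C k e count≤)

  -- One iteration may cost a factor `N` more than the others, since that is the order of the whole
  -- loop anyway.
  for-cost-except : ∀ a b p C D k s t → suc (value b t) ∸ value a t ≤ N →
    (∀ v t′ → v ∈[ value a t , value b t ] → v ≢ s → cost (p v) t′ ≤ C * N ^ k) →
    (∀ t′ → s ∈[ value a t , value b t ] → cost (p s) t′ ≤ D * N ^ suc k) →
    cost (for a b p) t ≤ (1 + exprCost a + exprCost b + (2 + C) + D) * N ^ suc k
  for-cost-except a b p C D k s t count≤ body bodyₛ = begin
    o + proj₂ (iterate count (value a t) (λ v → run X Y (p v)) t)
      ≤⟨ +-monoʳ-≤ o (iterate-cost-except (λ v → run X Y (p v)) (C * N ^ k) (D * N ^ suc k) s _ (value a t) t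
           (λ v t′ lo≤v v< → body v t′ (lo≤v , range-upper lo≤v v<))
           (λ t′ lo≤s s< → bodyₛ t′ (lo≤s , range-upper lo≤s s<))) ⟩
    o + (1 + count * (1 + C * N ^ k) + D * N ^ suc k)
      ≡⟨ sym (+-assoc o (1 + count * (1 + C * N ^ k)) (D * N ^ suc k)) ⟩
    o + (1 + count * (1 + C * N ^ k)) + D * N ^ suc k
      ≤⟨ +-monoˡ-≤ _ (loop-bound N o count C k 1 (subst (count ≤_) (sym (*-identityʳ N)) count≤)) ⟩
    (o + (2 + C)) * N ^ suc k + D * N ^ suc k
      ≡⟨ sym (*-distribʳ-+ (N ^ suc k) (o + (2 + C)) D) ⟩
    (o + (2 + C) + D) * N ^ suc k ∎
    where
    o count : ℕ
    o = 1 + exprCost a + exprCost b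
    count = suc (value b t) ∸ value a t

  ≤N^1 : ∀ {m} → m ≤ N → m ≤ N ^ 1
  ≤N^1 {m} = subst (m ≤_) (sym (*-identityʳ N))

  range≤N : ∀ {hi} lo → hi ≤ n → suc hi ∸ lo ≤ N
  range≤N {hi} lo hi≤n = ≤-trans (m∸n≤m (suc hi) lo) (s≤s hi≤n)

  matchCell-cost : ∀ i j k l p q t → cost (matchCell i j k l p q) t ≤ 12 * N ^ 0
  matchCell-cost i j k l p q t =
    -- 6 units for the branch with its test and at most 6 for the assignment.
    +-monoʳ-≤ 6 (if-cost (Run.test X Y (x[ # p ] ≐ y[ # q ]) t) {K = 6} ≤-refl z≤n)

  matches-cost : ∀ i j k l t e e′ → suc j ∸ i ≤ N ^ e → suc l ∸ k ≤ N ^ e′ →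
    cost (matches X Y i j k l) t ≤ 22 * N ^ (e + (e′ + 0))
  matches-cost i j k l t e e′ rows columns =
    for-cost (# i) (# j) (matchRow X Y i j k l) 17 (e′ + 0) e t rows λ p t _ →
    for-cost (# k) (# l) (matchCell i j k l p) 12 0 e′ t columns λ q t _ →
    matchCell-cost i j k l p q t

  diagonal : ∀ i → suc i ∸ i ≤ 1
  diagonal i = ≤-reflexive (m+n∸n≡m 1 i)

  -- One of the two search ranges is a single position, so the double loop is linear.
  initCell-cost : ∀ i j k l t → i ≡ j ⊎ k ≡ l → j ≤ n → l ≤ n → cost (initCell i j k l) t ≤ 36 * N ^ 1
  initCell-cost i j k l t special j≤n l≤n = begin
    -- 14 is 6 for storing 0 plus 8 for the branch with its test.
    14 + proj₂ (if (i ≡ᵇ j) ∨ (k ≡ᵇ l) then run X Y (matches X Y i j k l) t′ else run X Y skip t′)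
      ≤⟨ +-mono-≤ (m≤m*n 14 (N ^ 1) {{m^n≢0 N 1}}) (if-cost ((i ≡ᵇ j) ∨ (k ≡ᵇ l)) (search special) z≤n) ⟩
    14 * N ^ 1 + 22 * N ^ 1
      ≡⟨ sym (*-distribʳ-+ (N ^ 1) 14 22) ⟩
    36 * N ^ 1 ∎
    where
    t′ : Table
    t′ = t [ i , j , k , l ↦ 0 ]
    search : i ≡ j ⊎ k ≡ l → cost (matches X Y i j k l) t′ ≤ 22 * N ^ 1
    search (inj₁ refl) = matches-cost i j k l t′ 0 1 (diagonal i) (≤N^1 (range≤N k l≤n))
    search (inj₂ refl) = matches-cost i j k l t′ 1 0 (≤N^1 (range≤N i j≤n)) (diagonal k)

  initCell-cost-off : ∀ i j k l t → i ≢ j → k ≢ l → cost (initCell i j k l) t ≤ 14 * N ^ 0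
  initCell-cost-off i j k l t i≢j k≢l rewrite ≡ᵇ-≢ i≢j | ≡ᵇ-≢ k≢l = ≤-refl

  initRow : (i j k : ℕ) → Cmd
  initRow i j k = For l from # 1 to # n Do initCell i j k l

  initPlane : (i j : ℕ) → Cmd
  initPlane i j = For k from # 1 to # n Do initRow i j k

  initRow-cost : ∀ i j k t → i ≡ j → j ≤ n → cost (initRow i j k) t ≤ 41 * N ^ 2
  initRow-cost i j k t i≡j j≤n = for-cost (# 1) (# n) (initCell i j k) 36 1 1 t (≤N^1 (range≤N 1 ≤-refl))
    λ l t (_ , l≤n) → initCell-cost i j k l t (inj₁ i≡j) j≤n l≤n

  initRow-cost-off : ∀ i j k t → i ≢ j → j ≤ n → cost (initRow i j k) t ≤ 55 * N ^ 1
  -- The exceptional iteration is `l = k`, the only one that searches.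
  initRow-cost-off i j k t i≢j j≤n = for-cost-except (# 1) (# n) (initCell i j k) 14 36 0 k t (range≤N 1 ≤-refl)
    (λ l t _ l≢k → initCell-cost-off i j k l t i≢j (≢-sym l≢k))
    (λ t (_ , k≤n) → initCell-cost i j k k t (inj₂ refl) j≤n k≤n)

  initPlane-cost : ∀ i j t → i ≡ j → j ≤ n → cost (initPlane i j) t ≤ 46 * N ^ 3
  initPlane-cost i j t i≡j j≤n = for-cost (# 1) (# n) (initRow i j) 41 2 1 t (≤N^1 (range≤N 1 ≤-refl))
    λ k t _ → initRow-cost i j k t i≡j j≤n

  initPlane-cost-off : ∀ i j t → i ≢ j → j ≤ n → cost (initPlane i j) t ≤ 60 * N ^ 2
  initPlane-cost-off i j t i≢j j≤n = for-cost (# 1) (# n) (initRow i j) 55 1 1 t (≤N^1 (range≤N 1 ≤-refl))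
    λ k t _ → initRow-cost-off i j k t i≢j j≤n

  initialize-cost : ∀ t → cost (initialize n) t ≤ 116 * N ^ 4
  initialize-cost t =
    for-cost (# 1) (# n) (λ i → For j from # 1 to # n Do initPlane i j) 111 3 1 t (≤N^1 (range≤N 1 ≤-refl)) λ i t _ →
    for-cost-except (# 1) (# n) (initPlane i) 60 46 2 i t (range≤N 1 ≤-refl)
      (λ j t (_ , j≤n) j≢i → initPlane-cost-off i j t (≢-sym j≢i) j≤n)
      (λ t (_ , i≤n) → initPlane-cost i i t refl i≤n)

  fillCell-cost : ∀ i j k l t → cost (fillCell i j k l) t ≤ 54
  fillCell-cost i j k l t =
    -- 18 units for the branch with its test; the two possible assignments take 20 and 36.
    +-monoʳ-≤ 18 (if-cost (Run.test X Y ((x[ # i ] ≐ x[ # j ]) and (x[ # j ] ≐ y[ # k ]) and (y[ # k ] ≐ y[ # l ])) t)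
      {K = 36} (m≤m+n 20 16) ≤-refl)

  starts≤N : ∀ {a} → a ∈[ 2 , n ] → suc (n ∸ a + 1) ∸ 1 ≤ N ^ 1
  starts≤N {a} (_ , a≤n) = ≤N^1 (≤-trans (≤-reflexive (last-start a≤n)) (m∸n≤m N a))

  fillRound-cost : ∀ a b t → a ∈[ 2 , n ] → b ∈[ 2 , n ] → cost (fillRound n a b) t ≤ 84 * N ^ 2
  fillRound-cost a b t a∈ b∈ =
    for-cost (# 1) (# n ⊟ # a ⊞ # 1)
      (λ i → For k from # 1 to # n ⊟ # b ⊞ # 1 Do cell i k) 75 1 1 t (starts≤N a∈) λ i t _ →
    for-cost (# 1) (# n ⊟ # b ⊞ # 1) (cell i) 66 0 1 t (starts≤N b∈) λ k t _ →
    -- 12 units set `j` and `l`, 6 for each.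
    +-monoʳ-≤ 12 (fillCell-cost i (i + a ∸ 1) k (k + b ∸ 1) t)
    where
    cell : (i k : ℕ) → Cmd
    cell i k = Set j := # i ⊞ # a ⊟ # 1 In Set l := # k ⊞ # b ⊟ # 1 In fillCell i j k l

  fill-cost : ∀ t → cost (fill n) t ≤ 94 * N ^ 4
  fill-cost t =
    for-cost (# 2) (# n) (λ a → For b from # 2 to # n Do fillRound n a b) 89 3 1 t (≤N^1 (range≤N 2 ≤-refl)) λ a t a∈ →
    for-cost (# 2) (# n) (fillRound n a) 84 2 1 t (≤N^1 (range≤N 2 ≤-refl)) λ b t b∈ →
    fillRound-cost a b t a∈ b∈

  LCPSLength-cost : ∀ t → runningTime X Y t ≤ 212 * N ^ 4
  LCPSLength-cost t = begin
    -- 2 units read the length and store it in `n`.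
    2 + (cost (initialize n) t + cost (fill n) (proj₁ (run X Y (initialize n) t)))
      ≤⟨ +-mono-≤ (m≤m*n 2 (N ^ 4) {{m^n≢0 N 4}}) (+-mono-≤ (initialize-cost t) (fill-cost _)) ⟩
    2 * N ^ 4 + (116 * N ^ 4 + 94 * N ^ 4)
      ≡⟨ cong (2 * N ^ 4 +_) (sym (*-distribʳ-+ (N ^ 4) 116 94)) ⟩
    2 * N ^ 4 + 210 * N ^ 4
      ≡⟨ sym (*-distribʳ-+ (N ^ 4) 2 210) ⟩
    212 * N ^ 4 ∎

-- From `n = 1` on, `suc n` is at most `2 * n`, which costs the factor `2 ^ 4`.
[1+n]^4∈O[n^4] : ∀ C → (λ n → C * suc n ^ 4) ∈O (λ n → n ^ 4)
[1+n]^4∈O[n^4] C = C * 2 ^ 4 , 1 , λ n 1≤n → begin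
  C * suc n ^ 4       ≤⟨ *-monoʳ-≤ C (^-monoˡ-≤ 4 (+-mono-≤ 1≤n (≤-reflexive (sym (+-identityʳ n))))) ⟩
  C * (2 * n) ^ 4     ≡⟨ cong (C *_) (^-distrib-* +-*-commutativeSemiring 2 n 4) ⟩
  C * (2 ^ 4 * n ^ 4) ≡⟨ sym (*-assoc C (2 ^ 4) (n ^ 4)) ⟩
  C * 2 ^ 4 * n ^ 4   ∎

theorem2 : ∀ (σ : ℕ) →
    (∀ (n : ℕ) .{{_ : NonZero n}} (X Y : Vec (Fin σ) n) (t₀ : Table) →
    ∃[ Z ] IsLCPS (toList X) (toList Y) Z × lcpsTable X Y t₀ 1 n 1 n ≡ length Z)
    × (∃[ T ] (∀ (n : ℕ) (X Y : Vec (Fin σ) n) (t₀ : Table) → runningTime X Y t₀ ≤ T n)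
    × T ∈O (λ n → n ^ 4))
theorem2 σ =
  (λ n X Y t₀ → optimal⇒lcps (toList X) (toList Y) (LCPSLength-correct X Y t₀ (>-nonZero⁻¹ n))) ,
  (λ n → 212 * suc n ^ 4) , (λ n → LCPSLength-cost) , [1+n]^4∈O[n^4] 212
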